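{- There is an absolute constant $c>0$ such that for every $n\ge 1$ and every unbounded fan-in Boolean circuit $C$ of depth $3$ computing the parity function on $n$ variables, $\mathsf{EC}(C)\ge c\,n$; that is, $\mathsf{EC}(C)=\Omega(n)$.
   Context: An unbounded fan-in Boolean circuit is a directed acyclic graph with a root node of out-degree zero, input gates (in-degree zero) labeled by variables $x_1,\dots,x_n$, and non-input gates (including the root) that are AND or OR gates of arbitrary fan-in or NOT gates. The depth is the length of the longest path from the root to an input gate, where NOT gates may appear anywhere and do not count toward the depth (only AND and OR gates form levels). For $a\in\{0,1\}^n$, $\mathsf{EC}(C,a)$ is the number of non-input gates of $C$ (including NOT gates) that output $1$ on $a$, and $\mathsf{EC}(C)=\max_{a\in\{0,1\}^n}\mathsf{EC}(C,a)$. The parity function is $x\mapsto x_1\oplus\cdots\oplus x_n$. -}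

module Defs where

open import Data.Bool using (Bool; true; false; not; _xor_; if_then_else_)
open import Data.Bool.ListAction using (and; or)
open import Data.Fin using (Fin)
open import Data.List using (List; []; _∷_; map; cartesianProductWith)
open import Data.List.NonEmpty using (List⁺; toList)
open import Data.List.Extrema.Nat using (max)
open import Data.Nat using (ℕ; zero; suc; _+_)
open import Data.Vec using (Vec; []; _∷_; lookup; foldr′)
open import Relation.Binary.PropositionalEquality using (_≡_)

-- A finite DAG is presented by listing its nodes in a topological order: a node
-- with m earlier nodes names its in-neighbours by elements of Fin m, where zero
-- is the most recent node.  Nodes may be shared (arbitrary out-degree), and
-- several input gates may carry the same variable.

-- Only input gates have in-degree zero, so fan-ins are non-empty.
data Gate (m : ℕ) : Set where
  AND OR : List⁺ (Fin m) → Gate m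
  NOT    : Fin m → Gate m

data Node (n m : ℕ) : Set where
  input : Fin n → Node n m
  gate  : Gate m → Node n m

infixl 5 _▷_

data DAG (n : ℕ) : ℕ → Set where
  []  : DAG n 0
  _▷_ : ∀ {m} → DAG n m → Node n m → DAG n (suc m)

-- The root is a non-input gate and has out-degree zero, so it can be put last.
record Circuit (n : ℕ) : Set where
  field
    {size} : ℕ
    below  : DAG n size
    root   : Gate size

  dag : DAG n (suc size)
  dag = below ▷ gate root

open Circuit public

evalGate : ∀ {m} → Vec Bool m → Gate m → Bool
evalGate v (AND is) = and (map (lookup v) (toList is))
evalGate v (OR is)  = or (map (lookup v) (toList is))
evalGate v (NOT i)  = not (lookup v i)

evalNode : ∀ {n m} → Vec Bool n → Vec Bool m → Node n m → Bool
evalNode a v (input x) = lookup a x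
evalNode a v (gate g)  = evalGate v g

values : ∀ {n m} → DAG n m → Vec Bool n → Vec Bool m
values []      a = []
values (D ▷ g) a = evalNode a (values D a) g ∷ values D a

output : ∀ {n} → Circuit n → Vec Bool n → Bool
output C a = evalGate (values (below C) a) (root C)

Computes : ∀ {n} → Circuit n → (Vec Bool n → Bool) → Set
Computes C f = ∀ a → output C a ≡ f a

-- The depth of a node is the largest number of AND and OR gates on a path from
-- it down to an input gate; NOT gates contribute nothing.
gateDepth : ∀ {m} → Vec ℕ m → Gate m → ℕ
gateDepth d (AND is) = suc (max 0 (map (lookup d) (toList is)))
gateDepth d (OR is)  = suc (max 0 (map (lookup d) (toList is)))
gateDepth d (NOT i)  = lookup d i

nodeDepth : ∀ {n m} → Vec ℕ m → Node n m → ℕ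
nodeDepth d (input x) = 0
nodeDepth d (gate g)  = gateDepth d g

depths : ∀ {n m} → DAG n m → Vec ℕ m
depths []      = []
depths (D ▷ g) = nodeDepth (depths D) g ∷ depths D

depth : ∀ {n} → Circuit n → ℕ
depth C = gateDepth (depths (below C)) (root C)

firing : ∀ {n m} → DAG n m → Vec Bool n → ℕ
firing []            a = 0
firing (D ▷ input x) a = firing D a
firing (D ▷ gate g)  a = (if evalGate (values D a) g then 1 else 0) + firing D a

ECat : ∀ {n} → Circuit n → Vec Bool n → ℕ
ECat C a = firing (dag C) a

assignments : ∀ n → List (Vec Bool n)
assignments zero    = [] ∷ []
assignments (suc n) = cartesianProductWith _∷_ (false ∷ true ∷ []) (assignments n)

EC : ∀ {n} → Circuit n → ℕ
EC C = max 0 (map (ECat C) (assignments _))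

parity : ∀ {n} → Vec Bool n → Bool
parity = foldr′ _xor_ false

{-# OPTIONS --safe #-}
module Submission where

-- Restrict variables in four rounds, fixing at most EC C of them in each, so that
-- after round k every gate of depth at most k is constant; a parity circuit of
-- depth 3 must then have no free variable left, whence n ≤ 4 · EC C.  Round 0
-- fixes the variables occurring negated: on the all-zeros input each of them
-- makes a NOT gate fire.  In round k ≥ 1 the inputs of an AND or OR gate of depth k
-- are free variables and constants, so it is monotone in the free variables.  If it
-- does not fire when these are all 1, it is constantly 0; otherwise fixing one free
-- variable makes it constant, and this is charged to its firing.

open import Data.Integer using (+_)
open import Data.Nat using (ℕ; _≥_)
open import Data.Product using (Σ-syntax; _×_)
open import Data.Rational using (ℚ; 0ℚ; _<_; _≤_; _*_; _/_)
open import Relation.Binary.PropositionalEquality using (_≡_)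
open import Defs

open import Data.Bool as Bool using (Bool; true; false; not; _∧_; _∨_; _xor_; f≤t; b≤b)
import Data.Bool.Properties as Bool
open import Algebra.Definitions {A = Bool} _≡_ using (Zero)
open import Data.Fin using (Fin; zero; suc)
import Data.Fin.Properties as Fin
import Data.Integer as ℤ
import Data.Integer.Properties as ℤ
open import Data.List as List using (List; []; _∷_; foldr)
open import Data.List.Extrema.Nat using (max)
open import Data.List.Membership.Propositional using () renaming (_∈_ to _∈ₗ_)
open import Data.List.Membership.Propositional.Properties
  using (∈-cartesianProductWith⁺; ∈-map⁺)
open import Data.List.NonEmpty using (toList)
open import Data.List.Relation.Unary.All as All using (All; []; _∷_)
import Data.List.Relation.Unary.All.Properties as All
open import Data.List.Relation.Unary.Any using (Any; here; there)
open import Data.Maybe using (Maybe; just; nothing; fromMaybe)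
open import Data.Nat as ℕ using (zero; suc; s≤s)
import Data.Nat.Properties as ℕ
open import Data.List.Extrema ℕ.≤-totalOrder using (xs≤max)
open import Data.Product using (∃-syntax; _,_; proj₁; proj₂)
import Data.Rational as ℚ
import Data.Rational.Properties as ℚ
import Data.Rational.Unnormalised as ℚᵘ
import Data.Rational.Unnormalised.Properties as ℚᵘ
open import Data.Sum using (_⊎_; inj₁; inj₂)
open import Data.Vec as Vec using (Vec; []; _∷_; lookup; replicate; _[_]≔_)
open import Data.Vec.Properties
  using (lookup-map; lookup-replicate; lookup∘update; lookup∘update′)
open import Function using (_∘_; id)
open import Relation.Binary.Definitions using (tri<; tri≈; tri>)
open import Relation.Binary.PropositionalEquality
  using (_≢_; refl; sym; trans; cong; cong₂; subst; subst₂)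
open import Relation.Nullary using (yes; no; contradiction)

-- Subcubes

-- A restriction of the variables: `nothing` marks those left free.
Cube : ℕ → Set
Cube = Vec (Maybe Bool)

private variable
  m n : ℕ
  P Q : Cube n
  a b w : Vec Bool n

record _∈_ (b : Vec Bool n) (Q : Cube n) : Set where
  constructor agreeing
  field agrees : ∀ x {v} → lookup Q x ≡ just v → lookup b x ≡ v

open _∈_

_⊑_ : Cube n → Cube n → Set
Q ⊑ P = ∀ {b} → b ∈ Q → b ∈ P

free : Cube n → ℕ
free []            = 0
free (nothing ∷ Q) = suc (free Q)
free (just _ ∷ Q)  = free Q

free-replicate : ∀ n → free (replicate n nothing) ≡ n
free-replicate zero    = refl
free-replicate (suc n) = cong suc (free-replicate n)

free-fix : ∀ (Q : Cube n) x v → free Q ℕ.≤ suc (free (Q [ x ]≔ just v))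
free-fix (nothing ∷ Q) zero    v = ℕ.≤-refl
free-fix (just _ ∷ Q)  zero    v = ℕ.n≤1+n _
free-fix (nothing ∷ Q) (suc x) v = s≤s (free-fix Q x v)
free-fix (just _ ∷ Q)  (suc x) v = free-fix Q x v

fix-⊑ : ∀ {Q : Cube n} {x} v → lookup Q x ≡ nothing → (Q [ x ]≔ just v) ⊑ Q
fix-⊑ {Q = Q} {x} v x-free {b} b∈Q′ = agreeing on-Q
  where
  on-Q : ∀ y {u} → lookup Q y ≡ just u → lookup b y ≡ u
  on-Q y Qy with y Fin.≟ x
  ... | yes refl = contradiction (trans (sym x-free) Qy) λ ()
  ... | no y≢x   = agrees b∈Q′ y (trans (lookup∘update′ y≢x Q (just v)) Qy)

fix-value : ∀ (Q : Cube n) x {v} → b ∈ (Q [ x ]≔ just v) → lookup b x ≡ v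
fix-value Q x b∈Q′ = agrees b∈Q′ x (lookup∘update x Q _)

-- The greatest point of the subcube, and the input whose firing gates pay for every round after
-- round 0.
top : Cube n → Vec Bool n
top = Vec.map (fromMaybe true)

top-∈ : ∀ (P : Cube n) → top P ∈ P
top-∈ P = agreeing λ x Px → trans (lookup-map x _ P) (cong (fromMaybe true) Px)

top-max : ∀ (P : Cube n) x → b ∈ P → lookup b x Bool.≤ lookup (top P) x
top-max P x b∈P with lookup P x in Px
... | just v  = Bool.≤-reflexive (trans (agrees b∈P x Px) (sym (agrees (top-∈ P) x Px)))
... | nothing = subst (_ Bool.≤_)
  (sym (trans (lookup-map x _ P) (cong (fromMaybe true) Px))) (Bool.≤-maximum _)

-- Settled nodes

BoolFun : ℕ → Set
BoolFun n = Vec Bool n → Bool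

Constant : Cube n → BoolFun n → Set
Constant Q f = ∃[ v ] (∀ {b} → b ∈ Q → f b ≡ v)

Variable : BoolFun n → Set
Variable f = ∃[ x ] (∀ b → f b ≡ lookup b x)

-- The index `d` is the depth of the node. Only depth 0 admits a variable, so a settled node of
-- positive depth is constant and stays so under a NOT gate.
Settled : Cube n → ℕ → BoolFun n → Set
Settled Q d f = (d ≡ 0 × Variable f) ⊎ Constant Q f

FreeVariable : Cube n → BoolFun n → Set
FreeVariable Q f = ∃[ x ] (lookup Q x ≡ nothing × (∀ b → f b ≡ lookup b x))

Settled-⊑ : ∀ {d} {f : BoolFun n} → Q ⊑ P → Settled P d f → Settled Q d f
Settled-⊑ Q⊑P (inj₁ var)        = inj₁ var
Settled-⊑ Q⊑P (inj₂ (v , f≡v)) = inj₂ (v , f≡v ∘ Q⊑P)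

constant-or-free : ∀ {d} {f : BoolFun n} → Settled Q d f → Constant Q f ⊎ FreeVariable Q f
constant-or-free (inj₂ const) = inj₁ const
constant-or-free {Q = Q} (inj₁ (_ , x , f≡x)) with lookup Q x in Qx
... | nothing = inj₂ (x , Qx , f≡x)
... | just v  = inj₁ (v , λ {b} b∈Q → trans (f≡x b) (agrees b∈Q x Qx))

-- Neither alternative involves a negated variable, so settled functions are monotone on the
-- subcube.
settled-top : ∀ {d} {f : BoolFun n} → Settled P d f → b ∈ P → f b Bool.≤ f (top P)
settled-top {P = P} {b} (inj₁ (_ , x , f≡x)) b∈P =
  subst₂ Bool._≤_ (sym (f≡x b)) (sym (f≡x (top P))) (top-max P x b∈P)
settled-top {P = P} (inj₂ (v , f≡v)) b∈P =
  Bool.≤-reflexive (trans (f≡v b∈P) (sym (f≡v (top-∈ P))))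

-- The second alternative is the charging scheme: a gate may cost one free variable only if it fires
-- on `w`.
Settles : Vec Bool n → Cube n → BoolFun n → Set
Settles w Q f = Constant Q f ⊎
  (f w ≡ true × ∃[ x ] ∃[ v ] (lookup Q x ≡ nothing × Constant (Q [ x ]≔ just v) f))

-- Treats AND and OR at once: `e` is the value of the empty fold and `z` the absorbing value.
module Connective
  (_∙_ : Bool → Bool → Bool) (e z : Bool)
  (z-zero : Zero z _∙_)
  (∙-mono : ∀ {p q r s} → p Bool.≤ q → r Bool.≤ s → (p ∙ r) Bool.≤ (q ∙ s))
  {I : Set} (val : I → BoolFun n)
  where

  fold : List I → BoolFun n
  fold is b = foldr _∙_ e (List.map (λ i → val i b) is)

  fold-constant : ∀ {is} → All (Constant Q ∘ val) is → Constant Q (fold is)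
  fold-constant []                = e , λ _ → refl
  fold-constant ((v , f≡v) ∷ cs) with fold-constant cs
  ... | u , fold≡u = v ∙ u , λ b∈Q → cong₂ _∙_ (f≡v b∈Q) (fold≡u b∈Q)

  fold-zero : ∀ {is} → Any (λ i → val i b ≡ z) is → fold is b ≡ z
  fold-zero {is = _ ∷ is} (here eq) = trans (cong (_∙ fold is _) eq) (proj₁ z-zero _)
  fold-zero (there any)             = trans (cong (_ ∙_) (fold-zero any)) (proj₂ z-zero _)

  fold-mono : ∀ {is} → All (λ i → val i a Bool.≤ val i b) is → fold is a Bool.≤ fold is b
  fold-mono []       = Bool.≤-refl
  fold-mono (p ∷ ps) = ∙-mono p (fold-mono ps)

  -- One free input is enough: giving its variable the absorbing value decides the whole fold,
  -- whatever the other inputs are.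
  constant-or-zeroable : ∀ is → All (λ i → Constant Q (val i) ⊎ FreeVariable Q (val i)) is →
    All (Constant Q ∘ val) is ⊎
    ∃[ x ] (lookup Q x ≡ nothing × (∀ {b} → lookup b x ≡ z → Any (λ i → val i b ≡ z) is))
  constant-or-zeroable [] [] = inj₁ []
  constant-or-zeroable (i ∷ is) (inj₂ (x , x-free , f≡x) ∷ ps) =
    inj₂ (x , x-free , λ {b} bx≡z → here (trans (f≡x b) bx≡z))
  constant-or-zeroable (i ∷ is) (inj₁ c ∷ ps) with constant-or-zeroable is ps
  ... | inj₁ cs                  = inj₁ (c ∷ cs)
  ... | inj₂ (x , x-free , any) = inj₂ (x , x-free , there ∘ any)

  -- A monotone gate that is 0 at the greatest point is 0 throughout. The test point is `top P`
  -- rather than `top Q`, because one input must witness all charges of a round while `Q` shrinks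
  -- during it.
  fold-settles : ∀ {d : I → ℕ} is → Q ⊑ P → All (λ i → Settled P (d i) (val i)) is →
    Settles (top P) Q (fold is)
  fold-settles {Q = Q} {P = P} is Q⊑P settled with fold is (top P) in fires
  ... | false = inj₁ (false , λ b∈Q → Bool.≤-antisym
    (subst (_ Bool.≤_) fires (fold-mono (All.map (λ s → settled-top s (Q⊑P b∈Q)) settled)))
    (Bool.≤-minimum _))
  ... | true with constant-or-zeroable is (All.map (constant-or-free ∘ Settled-⊑ Q⊑P) settled)
  ...   | inj₁ cs                  = inj₁ (fold-constant cs)
  ...   | inj₂ (x , x-free , any) =
    inj₂ (refl , x , z , x-free , z , λ b∈Q′ → fold-zero (any (fix-value Q x b∈Q′)))

∧-mono : ∀ {p q r s} → p Bool.≤ q → r Bool.≤ s → (p ∧ r) Bool.≤ (q ∧ s)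
∧-mono f≤t         r≤s = Bool.≤-minimum _
∧-mono {false} b≤b r≤s = b≤b
∧-mono {true}  b≤b r≤s = r≤s

∨-mono : ∀ {p q r s} → p Bool.≤ q → r Bool.≤ s → (p ∨ r) Bool.≤ (q ∨ s)
∨-mono f≤t         r≤s = Bool.≤-maximum _
∨-mono {false} b≤b r≤s = r≤s
∨-mono {true}  b≤b r≤s = b≤b

-- Rounds of restrictions

value : DAG n m → Fin m → BoolFun n
value D i b = lookup (values D b) i

depthAt : DAG n m → Fin m → ℕ
depthAt D i = lookup (depths D) i

SettledBelow : ℕ → Cube n → DAG n m → Set
SettledBelow k Q D = ∀ i → depthAt D i ℕ.< k → Settled Q (depthAt D i) (value D i)

gateFun : DAG n m → Gate m → BoolFun n
gateFun D g b = evalGate (values D b) g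

-- `P` is the subcube at the start of round `k`, `Q` the one reached when `g` is visited. The inputs
-- of an AND or OR gate are shallower and were settled on `P`; the input of a NOT gate has the same
-- depth as the gate and is settled only on `Q`.
SettlesLevel : ℕ → Cube n → Vec Bool n → Set
SettlesLevel {n} k P w =
  ∀ {m} (D : DAG n m) g Q → Q ⊑ P → SettledBelow k P D → SettledBelow (suc k) Q D →
  gateDepth (depths D) g ≡ k → Settles w Q (gateFun D g)

firing-gate : ∀ (D : DAG n m) g w → firing D w ℕ.≤ firing (D ▷ gate g) w
firing-gate D g w = ℕ.m≤n+m _ _

-- The nodes are visited in topological order, so the inputs of a gate are treated before it. Each
-- gate of depth `k` is charged at most once, to its own firing on the common input `w`.
round : ∀ {k} → SettlesLevel k P w → (D : DAG n m) → SettledBelow k P D →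
  ∃[ Q ] (Q ⊑ P × SettledBelow (suc k) Q D × free P ℕ.≤ free Q ℕ.+ firing D w)
round {P = P} step [] below = P , id , (λ ()) , ℕ.m≤m+n _ _
round step (D ▷ input x) below with round step D (below ∘ suc)
... | Q , Q⊑P , settled , bound = Q , Q⊑P , settled′ , bound
  where
  settled′ : SettledBelow _ Q (D ▷ input x)
  settled′ zero    _  = inj₁ (refl , x , λ _ → refl)
  settled′ (suc i) lt = settled i lt
round {n} {P = P} {w = w} {k = k} step (D ▷ gate g) below with round step D (below ∘ suc)
... | Q , Q⊑P , settled , bound = extend (ℕ.<-cmp (gateDepth (depths D) g) k)
  where
  Goal = ∃[ Q′ ] (Q′ ⊑ P × SettledBelow (suc k) Q′ (D ▷ gate g) ×
                  free P ℕ.≤ free Q′ ℕ.+ firing (D ▷ gate g) w)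

  bound′ : free P ℕ.≤ free Q ℕ.+ firing (D ▷ gate g) w
  bound′ = ℕ.≤-trans bound (ℕ.+-monoʳ-≤ (free Q) (firing-gate D g w))

  settled-∷ : ∀ {Q′} → Q′ ⊑ Q →
    (gateDepth (depths D) g ℕ.< suc k → Settled Q′ (gateDepth (depths D) g) (gateFun D g)) →
    SettledBelow (suc k) Q′ (D ▷ gate g)
  settled-∷ Q′⊑Q new zero    lt = new lt
  settled-∷ Q′⊑Q new (suc i) lt = Settled-⊑ Q′⊑Q (settled i lt)

  extend : _ → Goal
  extend (tri< d<k _ _) =
    Q , Q⊑P , settled-∷ id (λ _ → Settled-⊑ Q⊑P (below zero d<k)) , bound′
  extend (tri> _ _ k<d) =
    Q , Q⊑P , settled-∷ id (λ d<1+k → contradiction d<1+k (ℕ.≤⇒≯ k<d)) , bound′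
  extend (tri≈ _ d≡k _) with step D g Q Q⊑P (below ∘ suc) settled d≡k
  ... | inj₁ const = Q , Q⊑P , settled-∷ id (λ _ → inj₂ const) , bound′
  ... | inj₂ (fires , x , v , x-free , const) =
    Q [ x ]≔ just v , Q⊑P ∘ fix-⊑ v x-free ,
    settled-∷ (fix-⊑ v x-free) (λ _ → inj₂ const) , charged
    where
    open ℕ.≤-Reasoning
    charged : free P ℕ.≤ free (Q [ x ]≔ just v) ℕ.+ firing (D ▷ gate g) w
    -- As the gate fires, its `if` contributes 1, which pays for `x`.
    charged rewrite fires = begin
      free P                                          ≤⟨ bound ⟩
      free Q ℕ.+ firing D w                           ≤⟨ ℕ.+-monoˡ-≤ _ (free-fix Q x v) ⟩
      suc (free (Q [ x ]≔ just v)) ℕ.+ firing D w     ≡⟨ ℕ.+-suc _ _ ⟨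
      free (Q [ x ]≔ just v) ℕ.+ suc (firing D w)     ∎

inputs-shallower : ∀ {k} (d : Vec ℕ m) is → suc (max 0 (List.map (lookup d) is)) ≡ k →
  All (λ i → lookup d i ℕ.< k) is
inputs-shallower d is refl = All.map s≤s (All.map⁻ (xs≤max 0 (List.map (lookup d) is)))

not-constant : ∀ {f : BoolFun n} → Constant Q f → Constant Q (not ∘ f)
not-constant (v , f≡v) = not v , λ b∈Q → cong not (f≡v b∈Q)

-- Only NOT gates have depth 0. One that reads a variable fires on the all-zeros input.
settlesLevel-zero : SettlesLevel 0 (replicate n nothing) (replicate n false)
settlesLevel-zero D (NOT i) Q _ _ settled d≡0
  with constant-or-free (settled i (s≤s (ℕ.≤-reflexive d≡0)))
... | inj₁ const               = inj₁ (not-constant const)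
... | inj₂ (x , x-free , f≡x) = inj₂
  ( cong not (trans (f≡x _) (lookup-replicate x false))
  -- The value `false` is arbitrary: either value of `x` makes the gate constant.
  , x , false , x-free
  , true , λ {b} b∈Q′ → cong not (trans (f≡x b) (fix-value Q x b∈Q′)))

settlesLevel-suc : ∀ k (P : Cube n) → SettlesLevel (suc k) P (top P)
settlesLevel-suc k P D (AND is) Q Q⊑P below _ d≡k =
  fold-settles (toList is) Q⊑P (All.map (below _) (inputs-shallower (depths D) (toList is) d≡k))
  where open Connective _∧_ true false Bool.∧-zero ∧-mono (value D)
settlesLevel-suc k P D (OR is) Q Q⊑P below _ d≡k =
  fold-settles (toList is) Q⊑P (All.map (below _) (inputs-shallower (depths D) (toList is) d≡k))
  where open Connective _∨_ false true Bool.∨-zero ∨-mono (value D)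
-- The input shares the positive depth of the gate, so it is already constant and nothing is
-- charged.
settlesLevel-suc k P D (NOT i) Q _ _ settled d≡k
  with settled i (s≤s (ℕ.≤-reflexive d≡k))
... | inj₁ (d≡0 , _) = contradiction (trans (sym d≡0) d≡k) λ ()
... | inj₂ const     = inj₁ (not-constant const)

-- Energy

∈-assignments : (a : Vec Bool n) → a ∈ₗ assignments n
∈-assignments []      = here refl
∈-assignments (v ∷ a) = ∈-cartesianProductWith⁺ _∷_ (∈-bools v) (∈-assignments a)
  where
  ∈-bools : ∀ v → v ∈ₗ (false ∷ true ∷ [])
  ∈-bools false = here refl
  ∈-bools true  = there (here refl)

firing≤EC : (C : Circuit n) (a : Vec Bool n) → firing (dag C) a ℕ.≤ EC C
firing≤EC C a = All.lookup (xs≤max 0 _) (∈-map⁺ (ECat C) (∈-assignments a))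

-- There is one round for each depth from 0 to `k`, each costing at most `EC C` variables.
settle : ∀ (C : Circuit n) k →
  ∃[ Q ] (SettledBelow (suc k) Q (dag C) × n ℕ.≤ free Q ℕ.+ suc k ℕ.* EC C)
-- Round 0 starts with every variable free, where `SettledBelow 0` is vacuous.
settle {n} C zero with round settlesLevel-zero (dag C) (λ _ ())
... | Q , _ , settled , bound = Q , settled , (begin
  n                               ≡⟨ free-replicate n ⟨
  free (replicate n nothing)      ≤⟨ bound ⟩
  free Q ℕ.+ firing (dag C) _     ≤⟨ ℕ.+-monoʳ-≤ (free Q) (firing≤EC C _) ⟩
  free Q ℕ.+ EC C                 ≡⟨ cong (free Q ℕ.+_) (ℕ.*-identityˡ (EC C)) ⟨
  free Q ℕ.+ 1 ℕ.* EC C           ∎)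
  where open ℕ.≤-Reasoning
settle {n} C (suc k) with settle C k
... | P , below , bound with round (settlesLevel-suc k P) (dag C) below
...   | Q , _ , settled , bound′ = Q , settled , (begin
  n                                                       ≤⟨ bound ⟩
  free P ℕ.+ suc k ℕ.* EC C                               ≤⟨ ℕ.+-monoˡ-≤ _ bound′ ⟩
  free Q ℕ.+ firing (dag C) (top P) ℕ.+ suc k ℕ.* EC C
    ≤⟨ ℕ.+-monoˡ-≤ _ (ℕ.+-monoʳ-≤ (free Q) (firing≤EC C _)) ⟩
  free Q ℕ.+ EC C ℕ.+ suc k ℕ.* EC C                      ≡⟨ ℕ.+-assoc (free Q) _ _ ⟩
  free Q ℕ.+ suc (suc k) ℕ.* EC C                         ∎)
  where open ℕ.≤-Reasoning

-- Flipping a free variable flips the parity, while a fixed variable only shifts the constant by its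
-- value.
parity-constant⇒no-free : (Q : Cube n) → Constant Q parity → free Q ≡ 0
parity-constant⇒no-free []            _           = refl
parity-constant⇒no-free (nothing ∷ Q) (v , p≡v) =
  contradiction (trans (p≡v (extended false)) (sym (p≡v (extended true))))
                (Bool.not-¬ refl)
  where
  extended : ∀ u → (u ∷ top Q) ∈ (nothing ∷ Q)
  extended u = agreeing λ { (suc x) → agrees (top-∈ Q) x }
parity-constant⇒no-free (just u ∷ Q)  (v , p≡v) =
  parity-constant⇒no-free Q (u xor v , λ {b} b∈Q →
    trans (sym (xor-cancel u (parity b))) (cong (u xor_) (p≡v (extended b∈Q))))
  where
  extended : b ∈ Q → (u ∷ b) ∈ (just u ∷ Q)
  extended b∈Q = agreeing λ { zero refl → refl ; (suc x) → agrees b∈Q x }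

  xor-cancel : ∀ u p → u xor (u xor p) ≡ p
  xor-cancel false p = refl
  xor-cancel true  p = Bool.not-involutive p

-- After the round for its own depth the root is constant, since positive depth rules out a
-- variable; a constant parity leaves nothing free.
n≤[1+depth]*EC : (C : Circuit n) → depth C ≢ 0 → Computes C parity →
  n ℕ.≤ suc (depth C) ℕ.* EC C
n≤[1+depth]*EC {n} C d≢0 computes with settle C (depth C)
-- Index `zero` is the most recent node, hence the root.
... | Q , settled , bound with settled zero ℕ.≤-refl
...   | inj₁ (d≡0 , _)  = contradiction d≡0 d≢0
...   | inj₂ (v , C≡v) = subst (λ f → n ℕ.≤ f ℕ.+ suc (depth C) ℕ.* EC C)
  (parity-constant⇒no-free Q (v , λ {b} b∈Q → trans (sym (computes b)) (C≡v b∈Q))) bound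

-- On unnormalised fractions the inequality is the hypothesis after cross-multiplication.
quarter-bound : ∀ n e → n ℕ.≤ 4 ℕ.* e → (+ 1 / 4) * (+ n / 1) ≤ (+ e / 1)
quarter-bound n e n≤4e = ℚ.toℚᵘ-cancel-≤ (begin
  ℚ.toℚᵘ ((+ 1 / 4) * (+ n / 1))              ≃⟨ ℚ.toℚᵘ-homo-* (+ 1 / 4) (+ n / 1) ⟩
  (+ 1 ℚᵘ./ 4) ℚᵘ.* ℚ.toℚᵘ (+ n / 1)          ≃⟨ ℚᵘ.*-congˡ {+ 1 ℚᵘ./ 4} (ℚ.toℚᵘ-fromℚᵘ (+ n ℚᵘ./ 1)) ⟩
  (+ 1 ℚᵘ./ 4) ℚᵘ.* (+ n ℚᵘ./ 1)              ≤⟨ ℚᵘ.*≤* (subst₂ ℤ._≤_ 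
    (sym (trans (ℤ.*-identityʳ _) (ℤ.*-identityˡ (+ n))))
    (trans (cong +_ (ℕ.*-comm 4 e)) (ℤ.pos-* e 4)) (ℤ.+≤+ n≤4e)) ⟩
  + e ℚᵘ./ 1                                  ≃⟨ ℚ.toℚᵘ-fromℚᵘ (+ e ℚᵘ./ 1) ⟨
  ℚ.toℚᵘ (+ e / 1)                            ∎)
  where open ℚᵘ.≤-Reasoning

theorem1p4 : Σ[ c ∈ ℚ ] (0ℚ < c ×
    ((n : ℕ) → n ≥ 1 → (C : Circuit n) → depth C ≡ 3 → Computes C parity →
    c * (+ n / 1) ≤ (+ EC C / 1)))
theorem1p4 = + 1 / 4 , ℚ.positive⁻¹ (+ 1 / 4) , λ n _ C d≡3 computes →
  -- Depth 3 takes the four rounds 0 to 3, whence the constant 1/4.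
  quarter-bound n (EC C)
    (subst (λ d → n ℕ.≤ suc d ℕ.* EC C) d≡3
      (n≤[1+depth]*EC C (λ d≡0 → contradiction (trans (sym d≡0) d≡3) λ ()) computes))
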